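{- Let $s$ and $L \ge s+1$ be positive integers. Write $H_{L,s,L}(q) = \sum_{n\ge 0} a_{L,n} q^n$, and set $\eta_1(L,s) = \sum_{n<\Gamma(s)} |a_{L,n}|$, $\eta_2(L,s) = \max(\eta_1(L,s),\Gamma(s))$, $\eta_3(L,s) = (L+1)\eta_2(L,s)$. Then the coefficient of $q^n$ in $G_{L,s}(q)$ is nonnegative for every integer $n \ge \eta_3(L,s)$.
   Context: $(a;q)_n := (1-a)(1-aq)\cdots(1-aq^{n-1})$. A partition $\pi$ is a finite weakly decreasing sequence of positive integers; $|\pi|$ is the sum of its parts, $s(\pi)$ its smallest part and $l(\pi)$ its largest part. For positive integers $L,s$, $$G_{L,s}(q) := \sum_{\substack{\pi \text{ nonempty},\ s(\pi)=s,\\ l(\pi)-s(\pi)\le L}} q^{|\pi|} \;-\; \sum_{\substack{\pi \text{ nonempty},\ s(\pi)\ge s+1,\\ l(\pi)-s(\pi)\le L}} q^{|\pi|},$$ and for positive integers $L,s,k$, $H_{L,s,k}(q) := \frac{q^s(1-q^k)}{(q^s;q)_{L+1}} - \left(\frac{1}{(q^{s+1};q)_L}-1\right)$. Let $P_{L,s} = (s+1)(s+2)\cdots(s+L)$, $$\gamma(L,s) = \big((s+1)+\cdots+(s+L)\big)\cdot\Big(P_{L,s}^{(P_{L,s}^2-1)L+2} + \big((P_{L,s}^2-1)L-2\big)P_{L,s}\Big),$$ and $\Gamma(s) = \gamma(3s+2,s)$. -}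

module Defs where

open import Data.Nat as ℕ using (ℕ; zero; suc; _+_; _*_; _∸_; _^_; _⊔_; _≤ᵇ_; _≡ᵇ_)
open import Data.Integer as ℤ using (ℤ; +_; ∣_∣)
open import Data.Bool using (Bool; true; false; _∧_; if_then_else_)
open import Data.List using (List; []; _∷_; map; concatMap; filter; length; upTo)
open import Data.Nat.ListAction using (sum)
open import Data.Nat.Divisibility using (_∣?_)
open import Relation.Nullary.Decidable using (does)
open import Relation.Binary.PropositionalEquality using (_≡_)
open import Relation.Nullary using (Dec; yes; no)

-- Formal power series over ℤ in q, represented by their coefficient
-- sequences:  f ↦ (n ↦ coefficient of q^n in f).

Series : Set
Series = ℕ → ℤ

Σℤ< : ℕ → (ℕ → ℤ) → ℤ
Σℤ< zero    f = + 0
Σℤ< (suc n) f = Σℤ< n f ℤ.+ f n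

Σℕ< : ℕ → (ℕ → ℕ) → ℕ
Σℕ< zero    f = 0
Σℕ< (suc n) f = Σℕ< n f + f n

Πℕ< : ℕ → (ℕ → ℕ) → ℕ
Πℕ< zero    f = 1
Πℕ< (suc n) f = Πℕ< n f * f n

oneS : Series
oneS zero    = + 1
oneS (suc _) = + 0

monoS : ℕ → Series
monoS k n = if k ≡ᵇ n then + 1 else + 0

_+S_ : Series → Series → Series
(f +S g) n = f n ℤ.+ g n

_-S_ : Series → Series → Series
(f -S g) n = f n ℤ.- g n

_*S_ : Series → Series → Series
(f *S g) n = Σℤ< (suc n) (λ i → f i ℤ.* g (n ∸ i))

-- 1 / (1 - q^j) = Σ_{m ≥ 0} q^{j m}   (used for j ≥ 1)
geomInv : ℕ → Series
geomInv j n = if does (j ∣? n) then + 1 else + 0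

-- 1 / (a; q)_m  with a = q^b, i.e.  Π_{i<m} 1/(1 - q^{b+i})  (used for b ≥ 1)
invPoch : ℕ → ℕ → Series
invPoch b zero    = oneS
invPoch b (suc m) = invPoch b m *S geomInv (b + m)

H : ℕ → ℕ → ℕ → Series
H L s k = ((monoS s *S (oneS -S monoS k)) *S invPoch s (suc L))
          -S (invPoch (suc s) L -S oneS)

allLists : ℕ → ℕ → List (List ℕ)
allLists b zero      = [] ∷ []
allLists b (suc len) = [] ∷ concatMap (λ x → map (x ∷_) (allLists b len)) (map suc (upTo b))

positiveᵇ : List ℕ → Bool
positiveᵇ []       = true
positiveᵇ (x ∷ xs) = (1 ≤ᵇ x) ∧ positiveᵇ xs

decreasingᵇ : List ℕ → Bool
decreasingᵇ []           = true
decreasingᵇ (x ∷ [])     = true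
decreasingᵇ (x ∷ y ∷ xs) = (y ≤ᵇ x) ∧ decreasingᵇ (y ∷ xs)

isPartitionᵇ : List ℕ → Bool
isPartitionᵇ π = positiveᵇ π ∧ decreasingᵇ π

-- all partitions π with |π| = n (every such π has ≤ n parts, each ≤ n)
partitionsOf : ℕ → List (List ℕ)
partitionsOf n = filter (λ π → isPartitionᵇ π Data.Bool.≟ true)
                        (filter (λ π → sum π ℕ.≟ n) (allLists n n))
  where import Data.Bool

-- largest part l(π) (first entry of a decreasing list); 0 for the empty partition
largest : List ℕ → ℕ
largest []      = 0
largest (x ∷ _) = x

smallest : List ℕ → ℕ
smallest []           = 0
smallest (x ∷ [])     = x
smallest (x ∷ y ∷ xs) = smallest (y ∷ xs)

nonemptyᵇ : List ℕ → Bool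
nonemptyᵇ []      = false
nonemptyᵇ (_ ∷ _) = true

countᵇ : (List ℕ → Bool) → List (List ℕ) → ℕ
countᵇ p []       = 0
countᵇ p (x ∷ xs) = (if p x then 1 else 0) + countᵇ p xs

Gcoeff : ℕ → ℕ → ℕ → ℤ
Gcoeff L s n =
  + countᵇ (λ π → nonemptyᵇ π ∧ (smallest π ≡ᵇ s) ∧ (largest π ∸ smallest π ≤ᵇ L)) (partitionsOf n)
  ℤ.- + countᵇ (λ π → nonemptyᵇ π ∧ (suc s ≤ᵇ smallest π) ∧ (largest π ∸ smallest π ≤ᵇ L)) (partitionsOf n)

P : ℕ → ℕ → ℕ
P L s = Πℕ< L (λ i → s + suc i)

-- γ(L,s) = ((s+1)+⋯+(s+L)) · ( P^{(P²-1)L+2} + ((P²-1)L - 2) P )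
-- (for L, s ≥ 1 one has (P²-1)L ≥ 3, so the truncated subtraction is exact)
γ : ℕ → ℕ → ℕ
γ L s = Σℕ< L (λ i → s + suc i)
        * (P L s ^ ((P L s ^ 2 ∸ 1) * L + 2) + ((P L s ^ 2 ∸ 1) * L ∸ 2) * P L s)

Γ : ℕ → ℕ
Γ s = γ (3 * s + 2) s

a : ℕ → ℕ → ℕ → ℤ
a L s n = H L s L n

η₁ : ℕ → ℕ → ℕ
η₁ L s = Σℕ< (Γ s) (λ n → ∣ a L s n ∣)

η₂ : ℕ → ℕ → ℕ
η₂ L s = η₁ L s ⊔ Γ s

η₃ : ℕ → ℕ → ℕ
η₃ L s = suc L * η₂ L s

{-# OPTIONS --safe #-}
module Submission where

-- Let p(n) count the partitions of n into parts s+1, …, s+L. Classifying by the smallest part (and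
-- telescoping in the second case), G_{L,s} has n-th coefficient Σ_{i≥1} p(n-is) - Σ_{j≥0} p(n-jL),
-- up to a nonnegative correction, so its nonnegativity for n ≥ Γ(s) can be shown without H.
-- Since L > s, every d > s is a sum of parts, so p(n-d) ≤ p(n).
-- Hence the terms j ≥ 1 inject into the terms i ≥ 0 with i ≢ s mod s+1, and it remains to beat the
-- spurious term i = 0 and the term j = 0 by the unused ones: with σ = s(s+1),
-- 2 p(n) ≤ Σ_{k≥0} p(n - s² - kσ). A pigeonhole argument yields
-- p(n) ≤ p(n-e) + e p(n-Y) + Y p(n-V) for all e, Y, V and all n large in terms of s, Y and V only.
-- Applied with e = s² and e = s²+σ, this spends the terms k = 0, 1; suitable Y and V spend others.

open import Defs
open import Data.Nat using (ℕ; zero; suc; _+_; _*_; _∸_; _^_; _⊓_; _≤_; _<_; _≤ᵇ_; _≡ᵇ_; z≤n; s≤s;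
  NonZero; >-nonZero; >-nonZero⁻¹)
open import Data.Nat.Properties
open import Algebra.Properties.CommutativeSemigroup +-commutativeSemigroup using (interchange)
open import Data.Nat.Induction using (<-rec)
open import Data.Nat.ListAction using (sum)
open import Data.Nat.Tactic.RingSolver using (solve-∀)
open import Data.Bool using (Bool; true; false; _∧_; if_then_else_; T)
import Data.Bool as Bool
open import Data.Bool.Properties using (T-∧; T-≡; ∧-identityʳ; ∧-zeroʳ)
open import Data.List using (List; []; _∷_; map; concatMap; filter; upTo; applyUpTo; _++_)
open import Data.Product using (_×_; _,_; proj₁; proj₂; ∃-syntax)
open import Data.Sum using (inj₁; inj₂)
import Data.Integer.Properties as ℤ
open import Function using (_∘_; id; _⟨_⟩_; Equivalence)
open import Relation.Nullary using (Dec; does; yes; no; contradiction)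
open import Relation.Binary.Definitions using (tri<; tri≈; tri>)
open import Relation.Binary.PropositionalEquality

-- Nonnegative power series: shifts, geometric series and their products

-- shift k f is q^k · f.
shift : ℕ → (ℕ → ℕ) → ℕ → ℕ
shift zero    f n       = f n
shift (suc k) f zero    = 0
shift (suc k) f (suc n) = shift k f n

-- geom< c x f is (1 + q^x + ⋯ + q^{(c-1)x}) · f.
geom< : ℕ → ℕ → (ℕ → ℕ) → ℕ → ℕ
geom< zero    x f n = 0
geom< (suc c) x f n = f n + shift x (geom< c x f) n

-- geom x f is f / (1 - q^x), for x ≥ 1.
geom : ℕ → (ℕ → ℕ) → ℕ → ℕ
geom x f n = geom< (suc n) x f n

-- parts b k f is f / (q^b; q)_k, for b ≥ 1.
parts : ℕ → ℕ → (ℕ → ℕ) → ℕ → ℕ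
parts b zero    f = f
parts b (suc k) f = geom b (parts (suc b) k f)

unit : ℕ → ℕ
unit n = if 0 ≡ᵇ n then 1 else 0

sumFrom : ℕ → ℕ → (ℕ → ℕ) → ℕ
sumFrom b zero    h = 0
sumFrom b (suc k) h = h b + sumFrom (suc b) k h

-- Handing over the equation `k + m ≡ n` lets this serve inside strong inductions: for k ≥ 1 it
-- yields m < n.
shift-rel : (R : ℕ → ℕ → Set) → R 0 0 → ∀ k n {f g} →
            (∀ m → k + m ≡ n → R (f m) (g m)) → R (shift k f n) (shift k g n)
shift-rel R r zero    n       h = h n refl
shift-rel R r (suc k) zero    h = r
shift-rel R r (suc k) (suc n) h = shift-rel R r k n (λ m e → h m (cong suc e))

shift-mono : ∀ k {f g} → (∀ n → f n ≤ g n) → ∀ n → shift k f n ≤ shift k g n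
shift-mono k h n = shift-rel _≤_ z≤n k n (λ m _ → h m)

shift-cong : ∀ k {f g} → (∀ n → f n ≡ g n) → ∀ n → shift k f n ≡ shift k g n
shift-cong k h n = shift-rel _≡_ refl k n (λ m _ → h m)

+-nonZero-< : ∀ x .{{_ : NonZero x}} {m n} → x + m ≡ n → m < n
+-nonZero-< (suc x) {m} refl = s≤s (m≤n+m m x)

+-nonZero : ∀ x .{{_ : NonZero x}} k → NonZero (x + k)
+-nonZero (suc x) k = _

shift-+ : ∀ a b f n → shift a (shift b f) n ≡ shift (a + b) f n
shift-+ zero    b f n       = refl
shift-+ (suc a) b f zero    = refl
shift-+ (suc a) b f (suc n) = shift-+ a b f n

shift-comm : ∀ a b f n → shift a (shift b f) n ≡ shift b (shift a f) n
shift-comm a b f n = trans (shift-+ a b f n)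
  (trans (cong (λ c → shift c f n) (+-comm a b)) (sym (shift-+ b a f n)))

shift-add : ∀ k f g n → shift k (λ m → f m + g m) n ≡ shift k f n + shift k g n
shift-add zero    f g n       = refl
shift-add (suc k) f g zero    = refl
shift-add (suc k) f g (suc n) = shift-add k f g n

shift-zero : ∀ k n → shift k (λ _ → 0) n ≡ 0
shift-zero zero    n       = refl
shift-zero (suc k) zero    = refl
shift-zero (suc k) (suc n) = shift-zero k n

-- As x ≥ 1, the term q^{ix} contributes only from degree i on, so any number of terms above n gives
-- the same coefficient of q^n. This makes the index-dependent cutoff in `geom` harmless.
geom<-stable : ∀ c d x .{{_ : NonZero x}} f n → n < c → n < d → geom< c x f n ≡ geom< d x f n
geom<-stable (suc c) (suc d) x f n (s≤s n≤c) (s≤s n≤d) =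
  cong (f n +_) (shift-rel _≡_ refl x n (λ m e →
    geom<-stable c d x f m (≤-trans (+-nonZero-< x e) n≤c) (≤-trans (+-nonZero-< x e) n≤d)))

geom-unfold : ∀ x .{{_ : NonZero x}} f n → geom x f n ≡ f n + shift x (geom x f) n
geom-unfold x f n = cong (f n +_) (shift-rel _≡_ refl x n (λ m e →
  geom<-stable n (suc m) x f m (+-nonZero-< x e) ≤-refl))

-- The equation w = f + q^x w fixes each coefficient from earlier ones, so by strong induction
-- subsolutions lie below supersolutions.
compare : ∀ x .{{_ : NonZero x}} {u v f : ℕ → ℕ} →
          (∀ n → u n ≤ f n + shift x u n) → (∀ n → f n + shift x v n ≤ v n) →
          ∀ n → u n ≤ v n
compare x {u} {v} {f} hu hv = <-rec (λ n → u n ≤ v n) λ n ih → ≤-trans (hu n)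
  (≤-trans (+-monoʳ-≤ (f n) (shift-rel _≤_ z≤n x n (λ m e → ih (+-nonZero-< x e)))) (hv n))

geom-unique : ∀ x .{{_ : NonZero x}} {u f : ℕ → ℕ} →
              (∀ n → u n ≡ f n + shift x u n) → ∀ n → u n ≡ geom x f n
geom-unique x {f = f} h n = ≤-antisym
  (compare x (λ m → ≤-reflexive (h m)) (λ m → ≤-reflexive (sym (geom-unfold x f m))) n)
  (compare x (λ m → ≤-reflexive (geom-unfold x f m)) (λ m → ≤-reflexive (sym (h m))) n)

-- Abstracts multiplication by a power series with nonnegative coefficients; `comm` says that it
-- commutes with q^d.
record Linear (Φ : (ℕ → ℕ) → ℕ → ℕ) : Set where
  field
    mono : ∀ {f g} → (∀ n → f n ≤ g n) → ∀ n → Φ f n ≤ Φ g n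
    add  : ∀ f g n → Φ (λ m → f m + g m) n ≡ Φ f n + Φ g n
    none : ∀ n → Φ (λ _ → 0) n ≡ 0
    comm : ∀ d f n → Φ (shift d f) n ≡ shift d (Φ f) n

  congr : ∀ {f g} → (∀ n → f n ≡ g n) → ∀ n → Φ f n ≡ Φ g n
  congr h n = ≤-antisym (mono (λ m → ≤-reflexive (h m)) n) (mono (λ m → ≤-reflexive (sym (h m))) n)

  sum-shift : ∀ b k f n → Φ (λ m → sumFrom b k (λ z → shift z f m)) n
                          ≡ sumFrom b k (λ z → shift z (Φ f) n)
  sum-shift b zero    f n = none n
  sum-shift b (suc k) f n = trans (add (shift b f) (λ m → sumFrom (suc b) k (λ z → shift z f m)) n)
    (cong₂ _+_ (comm b f n) (sum-shift (suc b) k f n))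

open Linear

geom<-linear : ∀ c x → Linear (geom< c x)
geom<-linear zero    x = record
  { mono = λ _ _ → z≤n ; add = λ _ _ _ → refl ; none = λ _ → refl ; comm = λ d f n → sym (shift-zero d n) }
geom<-linear (suc c) x = record
  { mono = λ h n → +-mono-≤ (h n) (shift-mono x (mono ih h) n)
  ; add  = λ f g n → trans (cong (f n + g n +_) (trans (shift-cong x (add ih f g) n) (shift-add x _ _ n)))
                           (interchange (f n) (g n) _ _)
  ; none = λ n → trans (shift-cong x (none ih) n) (shift-zero x n)
  ; comm = λ d f n → sym (trans (shift-add d f _ n) (cong (shift d f n +_)
             (trans (shift-comm d x (geom< c x f) n) (shift-cong x (λ m → sym (comm ih d f m)) n))))
  }
  where
  ih = geom<-linear c x

geom-linear : ∀ x .{{_ : NonZero x}} → Linear (geom x)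
geom-linear x = record
  { mono = λ h n → mono (geom<-linear (suc n) x) h n
  ; add  = λ f g n → add (geom<-linear (suc n) x) f g n
  ; none = λ n → none (geom<-linear (suc n) x) n
  -- The cutoff of `geom` is n + 1 on one side and m + 1 on the other, where d + m = n; both exceed
  -- m.
  ; comm = λ d f n → trans (comm (geom<-linear (suc n) x) d f n) (shift-rel _≡_ refl d n (λ m e →
             geom<-stable (suc n) (suc m) x f m (s≤s (subst (m ≤_) e (m≤n+m m d))) ≤-refl))
  }

id-linear : Linear id
id-linear = record { mono = id ; add = λ _ _ _ → refl ; none = λ _ → refl ; comm = λ _ _ _ → refl }

∘-linear : ∀ {Φ Ψ} → Linear Φ → Linear Ψ → Linear (Φ ∘ Ψ)
∘-linear {Φ} {Ψ} p q = record
  { mono = λ h → mono p (mono q h)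
  ; add  = λ f g n → trans (congr p (add q f g) n) (add p (Ψ f) (Ψ g) n)
  ; none = λ n → trans (congr p (none q) n) (none p n)
  ; comm = λ d f n → trans (congr p (comm q d f) n) (comm p d (Ψ f) n)
  }

parts-linear : ∀ b .{{_ : NonZero b}} k → Linear (parts b k)
parts-linear b zero    = id-linear
parts-linear b (suc k) = ∘-linear (geom-linear b) (parts-linear (suc b) k)

parts-++ : ∀ b k m f → parts b (k + m) f ≡ parts b k (parts (b + k) m f)
parts-++ b zero    m f = cong (λ c → parts c m f) (sym (+-identityʳ b))
parts-++ b (suc k) m f = cong (geom b) (trans (parts-++ (suc b) k m f)
  (cong (λ c → parts (suc b) k (parts c m f)) (sym (+-suc b k))))

geom-≥ : ∀ x .{{_ : NonZero x}} f n → f n ≤ geom x f n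
geom-≥ x f n = m≤m+n (f n) _

parts-≥ : ∀ b .{{_ : NonZero b}} k f n → f n ≤ parts b k f n
parts-≥ b zero    f n = ≤-refl
parts-≥ b (suc k) f n = ≤-trans (parts-≥ (suc b) k f n) (geom-≥ b _ n)

-- `parts` splits off its smallest size b by definition. This is the recursion at the largest size b
-- + k: it is absent, or one copy is removed.
parts-unfoldʳ : ∀ b .{{_ : NonZero b}} k f n →
  parts b (suc k) f n ≡ parts b k f n + shift (b + k) (parts b (suc k) f) n
parts-unfoldʳ b k f n = trans (eq n) (trans (congr Φ (geom-unfold (b + k) f) n)
  (trans (add Φ f _ n) (cong (parts b k f n +_) (trans (comm Φ (b + k) _ n) (shift-cong (b + k) (sym ∘ eq) n)))))
  where
  Φ = parts-linear b k
  instance _ = +-nonZero b k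
  eq : ∀ n → parts b (suc k) f n ≡ parts b k (geom (b + k) f) n
  eq n = cong (λ h → h n) (trans (cong (λ m → parts b m f) (sym (+-comm k 1))) (parts-++ b k 1 f))

parts-≤ : ∀ b .{{_ : NonZero b}} {k k'} f → k ≤ k' → ∀ n → parts b k f n ≤ parts b k' f n
parts-≤ b {k} {k'} f k≤k' n = subst (λ j → parts b k f n ≤ parts b j f n) (m+[n∸m]≡n k≤k')
  (subst (λ h → parts b k f n ≤ h n) (sym (parts-++ b k (k' ∸ k) f))
    (mono (parts-linear b k) (parts-≥ (b + k) (k' ∸ k) f) n))
  where instance _ = +-nonZero b k

-- Adding one part b + i is an injection.
parts-absorb : ∀ b .{{_ : NonZero b}} {k i} f → i < k → ∀ n → shift (b + i) (parts b k f) n ≤ parts b k f n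
parts-absorb b {suc k} {zero} f _ n rewrite +-identityʳ b =
  ≤-trans (m≤n+m _ _) (≤-reflexive (sym (geom-unfold b _ n)))
parts-absorb b {suc k} {suc i} f (s≤s i<k) n rewrite +-suc b i =
  ≤-trans (≤-reflexive (sym (comm (geom-linear b) (suc b + i) (parts (suc b) k f) n)))
          (mono (geom-linear b) (parts-absorb (suc b) f i<k) n)

-- Finite sums over intervals

sumFrom-mono : ∀ b k {h g} → (∀ z → b ≤ z → z < b + k → h z ≤ g z) → sumFrom b k h ≤ sumFrom b k g
sumFrom-mono b zero    h≤g = z≤n
sumFrom-mono b (suc k) h≤g = +-mono-≤ (h≤g b ≤-refl (m<m+n b (s≤s z≤n)))
  (sumFrom-mono (suc b) k (λ z b<z z< → h≤g z (<⇒≤ b<z) (subst (z <_) (sym (+-suc b k)) z<)))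

sumFrom-++ : ∀ b k m h → sumFrom b (k + m) h ≡ sumFrom b k h + sumFrom (b + k) m h
sumFrom-++ b zero    m h = cong (λ c → sumFrom c m h) (sym (+-identityʳ b))
sumFrom-++ b (suc k) m h = trans (cong (h b +_) (trans (sumFrom-++ (suc b) k m h)
  (cong (λ c → sumFrom (suc b) k h + sumFrom c m h) (sym (+-suc b k))))) (sym (+-assoc (h b) _ _))

sumFrom-snoc : ∀ b k h → sumFrom b (suc k) h ≡ sumFrom b k h + h (b + k)
sumFrom-snoc b k h = trans (cong (λ m → sumFrom b m h) (sym (+-comm k 1)))
  (trans (sumFrom-++ b k 1 h) (cong (sumFrom b k h +_) (+-identityʳ _)))

sumFrom-const : ∀ b k c → sumFrom b k (λ _ → c) ≡ k * c
sumFrom-const b zero    c = refl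
sumFrom-const b (suc k) c = cong (_ +_) (sumFrom-const (suc b) k c)

sumFrom-≤ : ∀ b k {h} c → (∀ z → b ≤ z → z < b + k → h z ≤ c) → sumFrom b k h ≤ k * c
sumFrom-≤ b k c h≤c = ≤-trans (sumFrom-mono b k h≤c) (≤-reflexive (sumFrom-const b k c))

sumFrom-cong : ∀ b k {h g} → (∀ z → b ≤ z → z < b + k → h z ≡ g z) → sumFrom b k h ≡ sumFrom b k g
sumFrom-cong b k e = ≤-antisym (sumFrom-mono b k (λ z p q → ≤-reflexive (e z p q)))
                               (sumFrom-mono b k (λ z p q → ≤-reflexive (sym (e z p q))))

-- Bounded multiplicities and the pigeonhole inequality

trunc : ℕ → ℕ → ℕ → (ℕ → ℕ) → ℕ → ℕ
trunc c b zero    f = f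
trunc c b (suc k) f = geom< c b (trunc c (suc b) k f)

geom-split : ∀ x .{{_ : NonZero x}} c f n → geom x f n ≡ geom< c x f n + shift (c * x) (geom x f) n
geom-split x zero    f n = refl
geom-split x (suc c) f n = trans (geom-unfold x f n) (trans
  (cong (f n +_) (trans (shift-cong x (geom-split x c f) n) (trans (shift-add x _ _ n)
     (cong (shift x (geom< c x f) n +_) (shift-+ x (c * x) (geom x f) n)))))
  (sym (+-assoc (f n) _ _)))

geom<-≤ : ∀ x .{{_ : NonZero x}} c f n → geom< c x f n ≤ geom x f n
geom<-≤ x c f n = ≤-trans (m≤m+n _ _) (≤-reflexive (sym (geom-split x c f n)))

trunc-≤ : ∀ c b .{{_ : NonZero b}} k f n → trunc c b k f n ≤ parts b k f n
trunc-≤ c b zero    f n = ≤-refl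
trunc-≤ c b (suc k) f n = ≤-trans (geom<-≤ b c _ n) (mono (geom-linear b) (trunc-≤ c (suc b) k f) n)

-- `trunc` keeps the partitions in which each size b, ..., b + k - 1 occurs fewer than c times. In
-- any other one some size y occurs at least c times, and c copies of it are removed.
pigeonhole : ∀ c b .{{_ : NonZero b}} k f n →
  parts b k f n ≤ sumFrom b k (λ y → shift (c * y) (parts b k f) n) + trunc c b k f n
pigeonhole c b zero    f n = ≤-refl
pigeonhole c b (suc k) f n = begin
  geom b g n                                                     ≡⟨ geom-split b c g n ⟩
  geom< c b g n + shift (c * b) (geom b g) n                     ≤⟨ +-monoˡ-≤ _ step ⟩
  (rest + trunc c b (suc k) f n) + shift (c * b) (geom b g) n    ≡⟨ +-comm _ (shift (c * b) (geom b g) n) ⟩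
  shift (c * b) (geom b g) n + (rest + trunc c b (suc k) f n)    ≡⟨ +-assoc (shift (c * b) (geom b g) n) rest _ ⟨
  (shift (c * b) (geom b g) n + rest) + trunc c b (suc k) f n    ∎
  where
  open ≤-Reasoning
  g = parts (suc b) k f
  rest = sumFrom (suc b) k (λ y → shift (c * y) (geom b g) n)
  lin = geom<-linear c b
  -- Bounding the multiplicity of b commutes with removing c copies of y; afterwards the bound on b
  -- is dropped.
  pull : ∀ i j m → geom< c b (λ m → sumFrom i j (λ y → shift (c * y) g m)) m
                   ≤ sumFrom i j (λ y → shift (c * y) (geom b g) m)
  pull i zero    m = ≤-reflexive (none lin m)
  pull i (suc j) m = ≤-trans (≤-reflexive (add lin _ _ m)) (+-mono-≤
    (≤-trans (≤-reflexive (comm lin (c * i) g m)) (shift-mono (c * i) (geom<-≤ b c g) m))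
    (pull (suc i) j m))
  step : geom< c b g n ≤ rest + trunc c b (suc k) f n
  step = ≤-trans (mono lin (pigeonhole c (suc b) k f) n)
    (≤-trans (≤-reflexive (add lin _ _ n)) (+-monoˡ-≤ _ (pull (suc b) k n)))

trunc-zero : ∀ c b k n → trunc c b k (λ _ → 0) n ≡ 0
trunc-zero c b zero    n = refl
trunc-zero c b (suc k) n = trans (congr (geom<-linear c b) (trunc-zero c (suc b) k) n) (none (geom<-linear c b) n)

geom<-mono-from : ∀ c x a {f g} → (∀ n → a ≤ n → f n ≤ g n) →
                  ∀ n → c * x + a ≤ n → geom< c x f n ≤ geom< c x g n
geom<-mono-from zero    x a h n _  = z≤n
geom<-mono-from (suc c) x a h n le = +-mono-≤ (h n (≤-trans (m≤n+m a _) le))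
  (shift-rel _≤_ z≤n x n (λ m e → geom<-mono-from c x a h m
    (+-cancelˡ-≤ x _ _ (subst (x + (c * x + a) ≤_) (sym e) (subst (_≤ n) (+-assoc x (c * x) a) le)))))

-- `trunc` multiplies by a polynomial of degree at most the sum of cy over the sizes y, so for such
-- n only the values of f from index a on matter.
trunc-mono-from : ∀ c b k a {f g} → (∀ n → a ≤ n → f n ≤ g n) →
                  ∀ n → sumFrom b k (c *_) + a ≤ n → trunc c b k f n ≤ trunc c b k g n
trunc-mono-from c b zero    a h n le = h n le
trunc-mono-from c b (suc k) a h n le =
  geom<-mono-from c b (sumFrom (suc b) k (c *_) + a) (trunc-mono-from c (suc b) k a h) n
    (subst (_≤ n) (+-assoc (c * b) _ a) le)

trunc-one : ∀ b k f n → trunc 1 b k f n ≡ f n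
trunc-one b zero    f n = refl
trunc-one b (suc k) f n = trans (cong (trunc 1 (suc b) k f n +_) (shift-zero b n)) (trans (+-identityʳ _) (trunc-one (suc b) k f n))

-- The case c = 1 of `pigeonhole`: some size in the range occurs and loses one copy, or none occurs.
peel : ∀ b .{{_ : NonZero b}} k f n → parts b k f n ≤ sumFrom b k (λ y → shift y (parts b k f) n) + f n
peel b k f n = ≤-trans (pigeonhole 1 b k f n) (+-mono-≤
  (sumFrom-mono b k (λ y _ _ → ≤-reflexive (cong (λ d → shift d (parts b k f) n) (*-identityˡ y))))
  (≤-reflexive (trunc-one b k f n)))

-- Lowering or removing the smallest part

-- Lowering the smallest part z of a partition by e keeps it the smallest part, so this is an injection.
lower-smallest : ∀ b .{{_ : NonZero b}} e m n → 0 < n →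
  parts (b + e) m unit n ≤ shift e (parts b (e + m) unit) n
lower-smallest b e zero    (suc n) _ = z≤n
lower-smallest b e (suc m) n 0<n = begin
  parts (b + e) (suc m) unit n
    ≡⟨ geom-unfold (b + e) _ n ⟩
  parts (suc b + e) m unit n + shift (b + e) (parts (b + e) (suc m) unit) n
    -- If b + e occurs, one copy of it becomes b and the other parts stay; otherwise the range of
    -- sizes shrinks and induction applies.
    ≤⟨ +-mono-≤ (lower-smallest (suc b) e m n 0<n) (shift-mono (b + e) more n) ⟩
  shift e inner n + shift (b + e) whole n
    ≡⟨ cong (shift e inner n +_) (trans (cong (λ d → shift d whole n) (+-comm b e)) (sym (shift-+ e b whole n))) ⟩
  shift e inner n + shift e (shift b whole) n
    ≡⟨ shift-add e inner (shift b whole) n ⟨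
  shift e (λ i → inner i + shift b whole i) n
    ≡⟨ shift-cong e (λ i → sym (geom-unfold b inner i)) n ⟩
  shift e whole n
    ≡⟨ cong (λ k → shift e (parts b k unit) n) (sym (+-suc e m)) ⟩
  shift e (parts b (e + suc m) unit) n
    ∎
  where
  open ≤-Reasoning
  instance _ = +-nonZero b e
  inner whole : ℕ → ℕ
  inner = parts (suc b) (e + m) unit
  whole = parts b (suc (e + m)) unit
  more : ∀ i → parts (b + e) (suc m) unit i ≤ whole i
  more i = subst (λ k → parts (b + e) (suc m) unit i ≤ parts b k unit i) (+-suc e m)
    (subst (λ h → parts (b + e) (suc m) unit i ≤ h i) (sym (parts-++ b e (suc m) unit)) (parts-≥ b e _ i))

unit-pos : ∀ n → 0 < n → unit n ≤ 0
unit-pos (suc n) _ = z≤n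

-- If one of the e smallest sizes occurs, it is removed; otherwise all parts are at least b + e and
-- the smallest can be lowered by e. For m ≤ e every size may be removed, and n > 0 excludes the
-- empty partition.
lower-or-remove-smallest : ∀ b .{{_ : NonZero b}} e m → ∃[ k ] (k ≤ e × (∀ n → 0 < n →
  parts b m unit n ≤ sumFrom b k (λ z → shift z (parts b m unit) n) + shift e (parts b m unit) n))
lower-or-remove-smallest b e m with ≤-total m e
... | inj₁ m≤e = m , m≤e , λ n 0<n → ≤-trans (peel b m unit n)
      (+-monoʳ-≤ _ (≤-trans (unit-pos n 0<n) z≤n))
... | inj₂ e≤m with m≤n⇒∃[o]m+o≡n e≤m
...   | m′ , refl = e , ≤-refl , λ n 0<n → ≤-trans
      (subst (λ f → f n ≤ sumFrom b e (λ z → shift z f n) + parts (b + e) m′ unit n)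
        (sym (parts-++ b e m′ unit)) (peel b e (parts (b + e) m′ unit) n))
      (+-monoʳ-≤ _ (lower-smallest b e m′ n 0<n))

geom<-snoc : ∀ c x f n → geom< (suc c) x f n ≡ geom< c x f n + shift (c * x) f n
geom<-snoc zero    x f n = trans (cong (f n +_) (shift-zero x n)) (+-identityʳ (f n))
geom<-snoc (suc c) x f n = trans
  (cong (f n +_) (trans (shift-cong x (geom<-snoc c x f) n) (trans (shift-add x _ _ n)
    (cong (shift x (geom< c x f) n +_) (shift-+ x (c * x) f n)))))
  (sym (+-assoc (f n) _ _))

geom<-geom : ∀ c x y .{{_ : NonZero y}} f n →
             geom< c x (geom y f) n ≡ geom< c x f n + shift y (geom< c x (geom y f)) n
geom<-geom c x y f n = trans (congr Φ (geom-unfold y f) n)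
  (trans (add Φ f _ n) (cong (geom< c x f n +_) (comm Φ y _ n)))
  where Φ = geom<-linear c x

shift-geom-unfold : ∀ q x .{{_ : NonZero x}} f n →
                    shift q (geom x f) n ≡ shift q f n + shift (q + x) (geom x f) n
shift-geom-unfold q x f n = trans (shift-cong q (geom-unfold x f) n)
  (trans (shift-add q f _ n) (cong (shift q f n +_) (shift-+ q x (geom x f) n)))

-- Partitions into the sizes s + 1, ..., s + L

module Thresholds (s : ℕ) where

  -- `M₁` is the sum of the two values s² and s² + σ of e. Since σ = s² + s, `Y` equals s² + (1 +
  -- M₁)σ + (s + 1), so p(n - Y) is at most every term k ≤ 1 + M₁ of Σ p(n - s² - kσ). `V` does the
  -- same for k ≤ 1 + M₁ + 2Y.
  σ M₁ Y V : ℕ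
  σ  = suc s * s
  M₁ = s * s + (s * s + σ)
  Y  = (2 + M₁) * σ + 1
  V  = (2 + M₁ + (Y + Y)) * σ + 1

module _ (s L : ℕ) (s<L : s < L) where

  p : ℕ → ℕ
  p = parts (suc s) L unit

  -- Every d > s is a sum of parts of p, because s+1, …, 2s+1 all are.
  p-absorb : ∀ d → s < d → ∀ n → shift d p n ≤ p n
  p-absorb = <-rec _ go
    where
    go : ∀ d → (∀ {d′} → d′ < d → s < d′ → ∀ n → shift d′ p n ≤ p n) → s < d → ∀ n → shift d p n ≤ p n
    go d ih s<d n with m≤n⇒∃[o]m+o≡n s<d
    ... | r , refl with r <? L
    ...   | yes r<L = parts-absorb (suc s) unit r<L n
    ...   | no  r≮L = begin
      shift (suc s + r) p n        ≡⟨ shift-+ (suc s) r p n ⟨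
      shift (suc s) (shift r p) n  ≤⟨ shift-mono (suc s) (ih (m<n+m r (s≤s z≤n)) (<-≤-trans s<L (≮⇒≥ r≮L))) n ⟩
      shift (suc s) p n            ≡⟨ cong (λ d → shift d p n) (+-identityʳ (suc s)) ⟨
      shift (suc s + 0) p n        ≤⟨ parts-absorb (suc s) unit (≤-<-trans z≤n s<L) n ⟩
      p n                          ∎
      where open ≤-Reasoning

  p-antitone : ∀ {a b} → a + suc s ≤ b → ∀ n → shift b p n ≤ shift a p n
  p-antitone {a} {b} le n with m≤n⇒∃[o]m+o≡n le
  ... | r , refl = begin
    shift (a + suc s + r) p n        ≡⟨ cong (λ d → shift d p n) (+-assoc a (suc s) r) ⟩
    shift (a + (suc s + r)) p n      ≡⟨ shift-+ a (suc s + r) p n ⟨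
    shift a (shift (suc s + r) p) n  ≤⟨ shift-mono a (p-absorb (suc s + r) (m≤m+n (suc s) r)) n ⟩
    shift a p n                      ∎
    where open ≤-Reasoning

  -- Removing V copies of y ≥ s + 1 lowers n by at least V + (s + 1), so each term is at most p(n -
  -- V).
  copies-≤ : ∀ {k Y V} n → 0 < s → 2 ≤ V → k ≤ Y →
             sumFrom (suc s) k (λ y → shift (V * y) p n) ≤ Y * shift V p n
  copies-≤ {k} {Y} {V} n 0<s 2≤V k≤Y = ≤-trans
    (sumFrom-≤ (suc s) k (shift V p n) (λ y s<y _ → p-antitone (begin
      V + suc s      ≤⟨ +-monoʳ-≤ V (+-monoˡ-≤ s 0<s) ⟩
      V + (s + s)    ≡⟨ cong (λ t → V + (s + t)) (+-identityʳ s) ⟨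
      V + 2 * s      ≤⟨ +-monoʳ-≤ V (*-monoˡ-≤ s 2≤V) ⟩
      V + V * s      ≡⟨ *-suc V s ⟨
      V * suc s      ≤⟨ *-monoʳ-≤ V s<y ⟩
      V * y          ∎) n))
    (*-monoˡ-≤ _ k≤Y)
    where open ≤-Reasoning

  threshold : ∀ {k Y V n} → k ≤ Y → Y * (V * (s + Y)) < n → sumFrom (suc s) k (V *_) + 1 ≤ n
  threshold {k} {Y} {V} k≤Y big = ≤-trans (≤-reflexive (+-comm (sumFrom (suc s) k (V *_)) 1)) (≤-trans (s≤s
    (≤-trans (sumFrom-≤ (suc s) k (V * (s + Y)) (λ { y _ (s≤s y≤) → *-monoʳ-≤ V (≤-trans y≤ (+-monoʳ-≤ s k≤Y)) }))
             (*-monoˡ-≤ _ k≤Y))) big)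

  -- Partitions in which some part y ≤ s+Y occurs V times lose those V copies; any other partition
  -- of a large n has a part exceeding s+Y, and the smallest one is either lowered by e or, if it is
  -- at most s+Y+e, removed.
  p-bound : ∀ e Y V n → 0 < s → 2 ≤ V → Y * (V * (s + Y)) < n →
            p n ≤ shift e p n + e * shift Y p n + Y * shift V p n
  p-bound e Y V n 0<s 2≤V big with ≤-total L Y
  -- Here no size exceeds s + Y. As `unit` vanishes at positive indices, the truncated product
  -- contributes nothing beyond the threshold.
  ... | inj₁ L≤Y = begin
    p n
      ≤⟨ pigeonhole V (suc s) L unit n ⟩
    sumFrom (suc s) L (λ y → shift (V * y) p n) + trunc V (suc s) L unit n
      ≤⟨ +-mono-≤ (copies-≤ n 0<s 2≤V L≤Y)
           (trunc-mono-from V (suc s) L 1 {g = λ _ → 0} unit-pos n (threshold {V = V} L≤Y big)) ⟩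
    Y * shift V p n + trunc V (suc s) L (λ _ → 0) n
      ≡⟨ cong (Y * shift V p n +_) (trunc-zero V (suc s) L n) ⟩
    Y * shift V p n + 0
      ≡⟨ +-identityʳ _ ⟩
    Y * shift V p n
      ≤⟨ m≤n+m _ _ ⟩
    shift e p n + e * shift Y p n + Y * shift V p n ∎
    where open ≤-Reasoning
  ... | inj₂ Y≤L with m≤n⇒∃[o]m+o≡n Y≤L
  ...   | m , L≡ with lower-or-remove-smallest (suc s + Y) e m
  ...     | k , k≤e , large = begin
    p n
      ≡⟨ p≡ n ⟩
    small n
      ≤⟨ pigeonhole V (suc s) Y C n ⟩
    sumFrom (suc s) Y (λ y → shift (V * y) small n) + trunc V (suc s) Y C n
      ≡⟨ cong (λ f → sumFrom (suc s) Y (λ y → shift (V * y) f n) + trunc V (suc s) Y C n) (sym p≗) ⟩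
    sumFrom (suc s) Y (λ y → shift (V * y) p n) + trunc V (suc s) Y C n
      -- `large` needs a positive index; the threshold ensures that the parts above s + Y have a
      -- positive sum.
      ≤⟨ +-mono-≤ (copies-≤ {Y} n 0<s 2≤V ≤-refl) (trunc-mono-from V (suc s) Y 1 large n (threshold {Y} {V = V} ≤-refl big)) ⟩
    Y * shift V p n + trunc V (suc s) Y D n
      ≤⟨ +-monoʳ-≤ _ (trunc-≤ V (suc s) Y D n) ⟩
    Y * shift V p n + parts (suc s) Y D n
      ≡⟨ cong (Y * shift V p n +_) (trans (add lin _ _ n) (cong₂ _+_ (sum-shift lin (suc s + Y) k C n) (comm lin e C n))) ⟩
    Y * shift V p n + (sumFrom (suc s + Y) k (λ z → shift z small n) + shift e small n)
      ≡⟨ cong (λ f → Y * shift V p n + (sumFrom (suc s + Y) k (λ z → shift z f n) + shift e f n)) (sym p≗) ⟩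
    Y * shift V p n + (sumFrom (suc s + Y) k (λ z → shift z p n) + shift e p n)
      ≤⟨ +-monoʳ-≤ (Y * shift V p n) (+-monoˡ-≤ (shift e p n) (≤-trans
           (sumFrom-≤ (suc s + Y) k (shift Y p n) (λ z sY≤z _ → p-antitone (≤-trans (≤-reflexive (+-comm Y (suc s))) sY≤z) n))
           (*-monoˡ-≤ _ k≤e))) ⟩
    Y * shift V p n + (e * shift Y p n + shift e p n)
      ≡⟨ rotate (Y * shift V p n) (e * shift Y p n) (shift e p n) ⟩
    shift e p n + e * shift Y p n + Y * shift V p n
      ∎
    where
    open ≤-Reasoning
    C small D : ℕ → ℕ
    C = parts (suc s + Y) m unit
    small = parts (suc s) Y C
    D i = sumFrom (suc s + Y) k (λ z → shift z C i) + shift e C i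
    lin = parts-linear (suc s) Y
    p≗ : p ≡ small
    p≗ = trans (cong (λ l → parts (suc s) l unit) (sym L≡)) (parts-++ (suc s) Y m unit)
    p≡ : ∀ i → p i ≡ small i
    p≡ i = cong (λ f → f i) p≗
    rotate : ∀ x y z → x + (y + z) ≡ z + y + x
    rotate = solve-∀

  -- The doubling inequality and the comparison of steps L and s

  module _ .{{_ : NonZero s}} where

    open Thresholds s

    instance
      σ-nonZero : NonZero σ
      σ-nonZero = m*n≢0 (suc s) s

    -- Each copy of p(n - W) is charged to one of the terms k = a, ..., a + M - 1 of Σ p(n - s² -
    -- kσ), all of which dominate it because W ≥ s² + kσ + (s + 1).
    absorb-copies : ∀ a M W n → (a + M) * σ + 1 ≤ W →
      M * shift W p n + shift (s * s + (a + M) * σ) (geom σ p) n ≤ shift (s * s + a * σ) (geom σ p) n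
    absorb-copies a zero    W n _ rewrite +-identityʳ a = ≤-refl
    absorb-copies a (suc M) W n W≥ = begin
      shift W p n + M * shift W p n + shift (s * s + (a + suc M) * σ) (geom σ p) n
        ≡⟨ +-assoc (shift W p n) _ _ ⟩
      shift W p n + (M * shift W p n + shift (s * s + (a + suc M) * σ) (geom σ p) n)
        ≡⟨ cong (λ k → shift W p n + (M * shift W p n + shift (s * s + k * σ) (geom σ p) n)) (+-suc a M) ⟩
      shift W p n + (M * shift W p n + shift (s * s + (suc a + M) * σ) (geom σ p) n)
        ≤⟨ +-mono-≤ (p-antitone first n) (absorb-copies (suc a) M W n (subst (λ k → k * σ + 1 ≤ W) (+-suc a M) W≥)) ⟩
      shift (s * s + a * σ) p n + shift (s * s + suc a * σ) (geom σ p) n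
        ≡⟨ cong (λ d → shift (s * s + a * σ) p n + shift d (geom σ p) n) (next (s * s) (a * σ) σ) ⟩
      shift (s * s + a * σ) p n + shift (s * s + a * σ + σ) (geom σ p) n
        ≡⟨ shift-geom-unfold (s * s + a * σ) σ p n ⟨
      shift (s * s + a * σ) (geom σ p) n
        ∎
      where
      open ≤-Reasoning
      next : ∀ x y z → x + (z + y) ≡ x + y + z
      next = solve-∀
      expand : ∀ x y → x * x + y * ((1 + x) * x) + (1 + x) ≡ (1 + y) * ((1 + x) * x) + 1
      expand = solve-∀
      first : s * s + a * σ + suc s ≤ W
      first = ≤-trans (≤-reflexive (expand s a)) (≤-trans
        (+-monoˡ-≤ 1 (*-monoˡ-≤ σ (≤-trans (s≤s (m≤m+n a M)) (≤-reflexive (sym (+-suc a M)))))) W≥)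

    doubling : ∀ n → Y * (V * (s + Y)) < n → p n + p n ≤ shift (s * s) (geom σ p) n
    doubling n big = begin
      p n + p n
        ≤⟨ +-mono-≤ (p-bound (s * s) Y V n 0<s 2≤V big) (p-bound (s * s + σ) Y V n 0<s 2≤V big) ⟩
      (shift (s * s) p n + s * s * y + Y * v) + (shift (s * s + σ) p n + (s * s + σ) * y + Y * v)
        ≡⟨ regroup (shift (s * s) p n) (shift (s * s + σ) p n) (s * s) σ Y y v ⟩
      shift (s * s) p n + (shift (s * s + σ) p n + (M₁ * y + (Y + Y) * v))
        -- The 2Y copies of p(n - V) take the terms from k = 2 + M₁ on, leaving k = 2, ..., 1 + M₁
        -- for the copies of p(n - Y). The tail after those 2Y terms is discarded.
        ≤⟨ +-monoʳ-≤ (shift (s * s) p n) (+-monoʳ-≤ (shift (s * s + σ) p n) (+-monoʳ-≤ (M₁ * y) (≤-trans (m≤m+n ((Y + Y) * v) _) (absorb-copies (2 + M₁) (Y + Y) V n ≤-refl)))) ⟩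
      shift (s * s) p n + (shift (s * s + σ) p n + (M₁ * y + shift (s * s + (2 + M₁) * σ) (geom σ p) n))
        ≤⟨ +-monoʳ-≤ (shift (s * s) p n) (+-monoʳ-≤ (shift (s * s + σ) p n) (absorb-copies 2 M₁ Y n ≤-refl)) ⟩
      shift (s * s) p n + (shift (s * s + σ) p n + shift (s * s + 2 * σ) (geom σ p) n)
        ≡⟨ cong (λ d → shift (s * s) p n + (shift (s * s + σ) p n + shift d (geom σ p) n)) (two (s * s) σ) ⟩
      shift (s * s) p n + (shift (s * s + σ) p n + shift (s * s + σ + σ) (geom σ p) n)
        ≡⟨ cong (shift (s * s) p n +_) (shift-geom-unfold (s * s + σ) σ p n) ⟨
      shift (s * s) p n + shift (s * s + σ) (geom σ p) n
        ≡⟨ shift-geom-unfold (s * s) σ p n ⟨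
      shift (s * s) (geom σ p) n
        ∎
      where
      open ≤-Reasoning
      y = shift Y p n
      v = shift V p n
      0<s = >-nonZero⁻¹ s
      2≤V : 2 ≤ V
      2≤V = +-monoˡ-≤ 1 (*-mono-≤ {1} {2 + M₁ + (Y + Y)} (s≤s z≤n) (>-nonZero⁻¹ σ))
      two : ∀ a b → a + 2 * b ≡ a + b + b
      two = solve-∀
      regroup : ∀ a b q t Y y v → (a + q * y + Y * v) + (b + (q + t) * y + Y * v)
                                ≡ a + (b + ((q + (q + t)) * y + (Y + Y) * v))
      regroup = solve-∀

    -- The term of index j = us + r (r < s) on the left is paired with that of index u(s+1) + r on the right.
    pair-multiples : ∀ n d → s < d → shift d (geom L p) n ≤ geom< s s (geom σ p) n
    pair-multiples = <-rec _ go
      where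
      open ≤-Reasoning
      U = geom< s s (geom σ p)
      r = proj₁ (m≤n⇒∃[o]m+o≡n s<L)
      L≡ : suc s + r ≡ L
      L≡ = proj₂ (m≤n⇒∃[o]m+o≡n s<L)
      instance
        L-nonZero : NonZero L
        L-nonZero = >-nonZero (≤-<-trans z≤n s<L)
      -- Since L = s + (1 + r), extracting q^s at each step leaves an offset that only grows, so
      -- `p-absorb` applies to every term. Hence the arbitrary offset d > s.
      initial : ∀ c d n → s < d → shift d (geom< c L p) n ≤ geom< c s p n
      initial zero    d n _   = ≤-reflexive (shift-zero d n)
      initial (suc c) d n s<d = begin
        shift d (geom< (suc c) L p) n
          ≡⟨ shift-add d p _ n ⟩
        shift d p n + shift d (shift L (geom< c L p)) n
          ≡⟨ cong (shift d p n +_) (trans (shift-+ d L _ n) (trans (cong (λ e → shift e (geom< c L p) n) d+L≡)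
               (sym (shift-+ s (d + suc r) (geom< c L p) n)))) ⟩
        shift d p n + shift s (shift (d + suc r) (geom< c L p)) n
          ≤⟨ +-mono-≤ (p-absorb d s<d n) (shift-mono s (λ m → initial c (d + suc r) m (≤-trans s<d (m≤m+n d _))) n) ⟩
        p n + shift s (geom< c s p) n
          ∎
        where
        swap : ∀ d s r → d + (1 + s + r) ≡ s + (d + (1 + r))
        swap = solve-∀
        d+L≡ : d + L ≡ s + (d + suc r)
        d+L≡ = trans (cong (λ l → d + l) (sym L≡)) (swap d s r)
      -- A block of s terms advances the left by sL = σ + sr and the right by σ; the excess sr joins
      -- the offset.
      go : ∀ n → (∀ {m} → m < n → ∀ d → s < d → shift d (geom L p) m ≤ U m) →
           ∀ d → s < d → shift d (geom L p) n ≤ U n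
      go n ih d s<d = begin
        shift d (geom L p) n
          ≡⟨ trans (shift-cong d (geom-split L s p) n) (shift-add d (geom< s L p) _ n) ⟩
        shift d (geom< s L p) n + shift d (shift (s * L) (geom L p)) n
          ≡⟨ cong (shift d (geom< s L p) n +_) (trans (shift-+ d (s * L) _ n)
               (trans (cong (λ e → shift e (geom L p) n) d+sL≡) (sym (shift-+ σ (d + s * r) (geom L p) n)))) ⟩
        shift d (geom< s L p) n + shift σ (shift (d + s * r) (geom L p)) n
          ≤⟨ +-mono-≤ (initial s d n s<d) (shift-rel _≤_ z≤n σ n (λ m e →
               ih (+-nonZero-< σ e) (d + s * r) (≤-trans s<d (m≤m+n d _)))) ⟩
        geom< s s p n + shift σ U n
          ≡⟨ geom<-geom s s σ p n ⟨
        U n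
          ∎
        where
        swap : ∀ d s r → d + s * (1 + s + r) ≡ (1 + s) * s + (d + s * r)
        swap = solve-∀
        d+sL≡ : d + s * L ≡ σ + (d + s * r)
        d+sL≡ = trans (cong (λ l → d + s * l) (sym L≡)) (swap d s r)

    -- By 1/(1 - q^s) = (1 + q^s + ⋯ + q^{s·s})/(1 - q^σ), the indices i split into classes mod s +
    -- 1. The class of s pays for two copies of p(n) by `doubling`, the others for the terms j ≥ 1
    -- by `pair-multiples`.
    geom-L≤geom-s : ∀ n → Y * (V * (s + Y)) < n → geom L p n ≤ shift s (geom s p) n
    -- Adding p(n) to both sides supplies the term i = 0, which completes `shift s (geom s p)` to
    -- `geom s p`.
    geom-L≤geom-s n big = +-cancelˡ-≤ (p n) _ _ (begin
      p n + geom L p n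
        ≡⟨ cong (p n +_) (geom-unfold L p n) ⟩
      p n + (p n + shift L (geom L p) n)
        ≡⟨ +-assoc (p n) (p n) _ ⟨
      p n + p n + shift L (geom L p) n
        ≤⟨ +-mono-≤ (doubling n big) (pair-multiples n L s<L) ⟩
      shift (s * s) (geom σ p) n + geom< s s (geom σ p) n
        ≡⟨ trans (+-comm _ (geom< s s (geom σ p) n)) (sym (geom<-snoc s s (geom σ p) n)) ⟩
      geom< (suc s) s (geom σ p) n
        ≤⟨ compare σ (λ m → ≤-reflexive (geom<-geom (suc s) s σ p m))
                     (λ m → ≤-reflexive (sym (geom-split s (suc s) p m))) n ⟩
      geom s p n
        ≡⟨ geom-unfold s p n ⟩
      p n + shift s (geom s p) n
        ∎)
      where
      open ≤-Reasoning
      instance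
        L-nonZero : NonZero L
        L-nonZero = >-nonZero (≤-<-trans z≤n s<L)

-- Telescoping over the smallest part

-- Telescoping of (1 - q^L) q^t / (q^t; q)_{L+1} = 1 / (q^t; q)_L - 1 / (q^{t+1}; q)_L.
telescope : ∀ L .{{_ : NonZero L}} t .{{_ : NonZero t}} n →
  geom L (parts (suc t) L unit) n + shift t (parts t (suc L) unit) n ≡ geom L (parts t L unit) n
telescope L t = geom-unique L λ n → begin
  geom L g′ n + h n
    ≡⟨ cong (_+ h n) (geom-unfold L g′ n) ⟩
  g′ n + shift L (geom L g′) n + h n
    ≡⟨ swap (g′ n) _ (h n) ⟩
  g′ n + h n + shift L (geom L g′) n
    -- `K` is unfolded once at its smallest size t and once at its largest size t + L.
    ≡⟨ cong (_+ shift L (geom L g′) n) (trans (sym (geom-unfold t g′ n)) (parts-unfoldʳ t L unit n)) ⟩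
  g n + shift (t + L) K n + shift L (geom L g′) n
    ≡⟨ +-assoc (g n) _ _ ⟩
  g n + (shift (t + L) K n + shift L (geom L g′) n)
    ≡⟨ cong (g n +_) (+-comm (shift (t + L) K n) _) ⟩
  g n + (shift L (geom L g′) n + shift (t + L) K n)
    ≡⟨ cong (λ x → g n + (shift L (geom L g′) n + x))
         (trans (cong (λ d → shift d K n) (+-comm t L)) (sym (shift-+ L t K n))) ⟩
  g n + (shift L (geom L g′) n + shift L h n)
    ≡⟨ cong (g n +_) (shift-add L (geom L g′) h n) ⟨
  g n + shift L (λ m → geom L g′ m + h m) n
    ∎
  where
  open ≡-Reasoning
  g g′ K h : ℕ → ℕ
  g  = parts t L unit
  g′ = parts (suc t) L unit
  K  = parts t (suc L) unit
  h  = shift t K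
  swap : ∀ a b c → a + b + c ≡ a + c + b
  swap = solve-∀

-- By `telescope` each summand is a difference of consecutive values of 1/((1 - q^L)(q^t; q)_L). The
-- sum collapses, and the last value is dropped as nonnegative.
sum-smallest-≤ : ∀ L .{{_ : NonZero L}} t .{{_ : NonZero t}} k n →
  sumFrom t k (λ t → shift t (parts t (suc L) unit) n) ≤ geom L (parts t L unit) n
sum-smallest-≤ L t zero    n = z≤n
sum-smallest-≤ L t (suc k) n = ≤-trans
  (+-monoʳ-≤ (shift t (parts t (suc L) unit) n) (sum-smallest-≤ L (suc t) k n))
  (≤-reflexive (trans (+-comm (shift t (parts t (suc L) unit) n) _) (telescope L t n)))

-- Counting partitions

ind : Bool → ℕ
ind b = if b then 1 else 0

count-++ : ∀ f xs ys → countᵇ f (xs ++ ys) ≡ countᵇ f xs + countᵇ f ys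
count-++ f []       ys = refl
count-++ f (x ∷ xs) ys = trans (cong (ind (f x) +_) (count-++ f xs ys)) (sym (+-assoc (ind (f x)) _ _))

count-map : ∀ f (g : List ℕ → List ℕ) xs → countᵇ f (map g xs) ≡ countᵇ (f ∘ g) xs
count-map f g []       = refl
count-map f g (x ∷ xs) = cong (ind (f (g x)) +_) (count-map f g xs)

count-concatMap : ∀ f (g : ℕ → List (List ℕ)) h b c → (∀ i → suc (h i) ≡ b + i) →
  countᵇ f (concatMap g (map suc (applyUpTo h c))) ≡ sumFrom b c (λ x → countᵇ f (g x))
count-concatMap f g h b zero    _ = refl
count-concatMap f g h b (suc c) e = trans (count-++ f (g (suc (h 0))) _) (cong₂ _+_
  (cong (λ x → countᵇ f (g x)) (trans (e 0) (+-identityʳ b)))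
  (count-concatMap f g (h ∘ suc) (suc b) c (λ i → trans (e (suc i)) (+-suc b i))))

ind-mono : ∀ {a b} → (T a → T b) → ind a ≤ ind b
ind-mono {false}         _ = z≤n
ind-mono {true}  {true}  _ = ≤-refl
ind-mono {true}  {false} h with () ← h _

count-mono : ∀ {f g} → (∀ π → T (f π) → T (g π)) → ∀ xs → countᵇ f xs ≤ countᵇ g xs
count-mono h []       = z≤n
count-mono h (x ∷ xs) = +-mono-≤ (ind-mono (h x)) (count-mono h xs)

count-filter : ∀ f {P : List ℕ → Set} (P? : ∀ π → Dec (P π)) xs →
               countᵇ f (filter P? xs) ≡ countᵇ (λ π → does (P? π) ∧ f π) xs
count-filter f P? []       = refl
count-filter f P? (x ∷ xs) with does (P? x)
... | false = count-filter f P? xs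
... | true  = cong (ind (f x) +_) (count-filter f P? xs)

sumFrom-add : ∀ b k h g → sumFrom b k (λ z → h z + g z) ≡ sumFrom b k h + sumFrom b k g
sumFrom-add b zero    h g = refl
sumFrom-add b (suc k) h g = trans (cong (h b + g b +_) (sumFrom-add (suc b) k h g)) (interchange (h b) (g b) _ _)

sumFrom-member : ∀ b k {h} t → b ≤ t → t < b + k → h t ≤ sumFrom b k h
sumFrom-member b zero    t b≤t t< = contradiction (<-≤-trans t< (≤-reflexive (+-identityʳ b))) (≤⇒≯ b≤t)
sumFrom-member b (suc k) t b≤t t< with m≤n⇒m<n∨m≡n b≤t
... | inj₂ refl = m≤m+n _ _
... | inj₁ b<t  = ≤-trans (sumFrom-member (suc b) k t b<t (subst (t <_) (+-suc b k) t<)) (m≤n+m _ _)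

count-≤-sum : ∀ {f} {g : ℕ → List ℕ → Bool} b k →
  (∀ π → T (f π) → ∃[ t ] (b ≤ t × t < b + k × T (g t π))) →
  ∀ xs → countᵇ f xs ≤ sumFrom b k (λ t → countᵇ (g t) xs)
count-≤-sum b k h []       = z≤n
count-≤-sum {f} {g} b k h (x ∷ xs) = ≤-trans (+-mono-≤ step (count-≤-sum b k h xs))
  (≤-reflexive (sym (sumFrom-add b k (λ t → ind (g t x)) (λ t → countᵇ (g t) xs))))
  where
  step : ind (f x) ≤ sumFrom b k (λ t → ind (g t x))
  step with f x in fx
  ... | false = z≤n
  ... | true with h x (subst T (sym fx) _)
  ...   | t , b≤t , t< , gt = ≤-trans (ind-mono {true} (λ _ → gt)) (sumFrom-member b k t b≤t t<)

-- A bound u on the largest part replaces the bound on the difference, so that removing the first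
-- entry x leaves the same predicate with bound x. Positivity of the parts follows from the order
-- once t ≥ 1.
fits : ℕ → ℕ → ℕ → List ℕ → Bool
fits t u n π = (((nonemptyᵇ π ∧ decreasingᵇ π) ∧ (smallest π ≡ᵇ t)) ∧ (largest π ≤ᵇ u)) ∧ (sum π ≡ᵇ n)

emptyᵇ : List ℕ → Bool
emptyᵇ []      = true
emptyᵇ (_ ∷ _) = false

shift-ind : ∀ c x k n → shift x (λ m → ind (c ∧ (k ≡ᵇ m))) n ≡ ind (c ∧ (x + k ≡ᵇ n))
shift-ind c     zero    k n       = refl
shift-ind false (suc x) k zero    = refl
shift-ind true  (suc x) k zero    = refl
shift-ind c     (suc x) k (suc n) = shift-ind c x k n

-- The tail is either empty, forcing x = t, or fits with bound x.
fits-∷ : ∀ t u x n π → x ≤ u →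
  ind (fits t u n (x ∷ π)) ≡ shift x (λ m → ind (emptyᵇ π ∧ ((x ≡ᵇ t) ∧ (0 ≡ᵇ m))) + ind (fits t x m π)) n
fits-∷ t u x n [] x≤u with x ≤ᵇ u | ≤⇒≤ᵇ x≤u
... | true | _ = trans
  (trans (cong (λ b → ind (b ∧ (x + 0 ≡ᵇ n))) (∧-identityʳ (x ≡ᵇ t))) (sym (shift-ind (x ≡ᵇ t) x 0 n)))
  (shift-cong x (λ _ → sym (+-identityʳ _)) n)
fits-∷ t u x n (y ∷ π) x≤u with x ≤ᵇ u | ≤⇒≤ᵇ x≤u
... | true | _ = trans
  (cong (λ b → ind (b ∧ (x + sum (y ∷ π) ≡ᵇ n))) (reorder (y ≤ᵇ x) (decreasingᵇ (y ∷ π)) (smallest (y ∷ π) ≡ᵇ t)))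
  (sym (shift-ind _ x (sum (y ∷ π)) n))
  where
  reorder : ∀ a d e → ((a ∧ d) ∧ e) ∧ true ≡ (d ∧ e) ∧ a
  reorder false d     e     = sym (∧-zeroʳ (d ∧ e))
  reorder true  d     e     = refl

fits-∷-> : ∀ t u x n π → u < x → fits t u n (x ∷ π) ≡ false
fits-∷-> t u x n π u<x with x ≤ᵇ u in le
... | true  = contradiction (≤ᵇ⇒≤ x u (subst T (sym le) _)) (<⇒≱ u<x)
... | false = cong (_∧ (sum (x ∷ π) ≡ᵇ n)) (∧-zeroʳ ((nonemptyᵇ (x ∷ π) ∧ decreasingᵇ (x ∷ π)) ∧ (smallest (x ∷ π) ≡ᵇ t)))

count-∷ : ∀ t u x n xs → x ≤ u → countᵇ (fits t u n) (map (x ∷_) xs)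
  ≡ shift x (λ m → countᵇ (λ π → emptyᵇ π ∧ ((x ≡ᵇ t) ∧ (0 ≡ᵇ m))) xs + countᵇ (fits t x m) xs) n
count-∷ t u x n []       x≤u = sym (shift-zero x n)
count-∷ t u x n (π ∷ xs) x≤u = trans (cong₂ _+_ (fits-∷ t u x n π x≤u) (count-∷ t u x n xs x≤u))
  (trans (sym (shift-add x _ _ n)) (shift-cong x (λ m → interchange (ind (emptyᵇ π ∧ ((x ≡ᵇ t) ∧ (0 ≡ᵇ m)))) _ _ _) n))

count-∷-> : ∀ t u x n xs → u < x → countᵇ (fits t u n) (map (x ∷_) xs) ≡ 0
count-∷-> t u x n []       u<x = refl
count-∷-> t u x n (π ∷ xs) u<x = cong₂ _+_ (cong ind (fits-∷-> t u x n π u<x)) (count-∷-> t u x n xs u<x)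

-- The empty list occurs in `allLists` exactly once, at its head.
count-empty : ∀ b len c → countᵇ (λ π → emptyᵇ π ∧ c) (allLists b len) ≡ ind c
count-empty b zero      c = +-identityʳ (ind c)
count-empty b (suc len) c = trans (cong (ind c +_) (trans
  (count-concatMap _ (λ x → map (x ∷_) (allLists b len)) id 1 b (λ _ → refl))
  (n≤0⇒n≡0 (≤-trans (sumFrom-≤ 1 b 0 (λ x _ _ → ≤-reflexive (trans (count-map _ (x ∷_) (allLists b len)) (none-empty x (allLists b len)))))
                    (≤-reflexive (*-zeroʳ b))))))
  (+-identityʳ (ind c))
  where
  none-empty : ∀ x xs → countᵇ ((λ π → emptyᵇ π ∧ c) ∘ (x ∷_)) xs ≡ 0
  none-empty x []       = refl
  none-empty x (_ ∷ xs) = none-empty x xs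

-- The k admissible values of the largest part are t, …, t+k-1.
withSmallest : ℕ → ℕ → ℕ → ℕ
withSmallest t zero    n = 0
withSmallest t (suc k) n = shift t (parts t (suc k) unit) n

≡ᵇ-false : ∀ {m n} → m ≢ n → (m ≡ᵇ n) ≡ false
≡ᵇ-false {m} {n} m≢n with m ≡ᵇ n in e
... | false = refl
... | true  = contradiction (≡ᵇ⇒≡ m n (subst T (sym e) _)) m≢n

-- Raising the bound from v to v + 1 adds the partitions with largest part v + 1. Below t both sides
-- vanish, at t only copies of t arise, and above t this is `parts-unfoldʳ`.
withSmallest-suc : ∀ t .{{_ : NonZero t}} v n →
  withSmallest t (suc (suc v) ∸ t) n ≡ withSmallest t (suc v ∸ t) n
    + shift (suc v) (λ m → ind ((suc v ≡ᵇ t) ∧ (0 ≡ᵇ m)) + withSmallest t (suc (suc v) ∸ t) m) n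
withSmallest-suc t v n with <-cmp (suc v) t
... | tri< v<t v≢t _
  rewrite m≤n⇒m∸n≡0 v<t | m≤n⇒m∸n≡0 (<⇒≤ v<t) | ≡ᵇ-false v≢t = sym (shift-zero (suc v) n)
... | tri≈ _ refl _
  rewrite m+n∸n≡m 1 v | n∸n≡0 v | Equivalence.to T-≡ (≡⇒≡ᵇ v v refl) = shift-cong (suc v) (geom-unfold (suc v) unit) n
... | tri> _ v≢t (s≤s t≤v)
  rewrite +-∸-assoc 2 t≤v | +-∸-assoc 1 t≤v | ≡ᵇ-false v≢t = begin
  shift t (parts t (2 + i) unit) n
    ≡⟨ shift-cong t (parts-unfoldʳ t (suc i) unit) n ⟩
  shift t (λ m → parts t (suc i) unit m + shift (t + suc i) (parts t (2 + i) unit) m) n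
    ≡⟨ shift-add t (parts t (suc i) unit) _ n ⟩
  shift t (parts t (suc i) unit) n + shift t (shift (t + suc i) (parts t (2 + i) unit)) n
    ≡⟨ cong (shift t (parts t (suc i) unit) n +_) (trans (shift-comm t (t + suc i) _ n)
         (cong (λ d → shift d (shift t (parts t (2 + i) unit)) n) (trans (+-suc t i) (cong suc (m+[n∸m]≡n t≤v))))) ⟩
  shift t (parts t (suc i) unit) n + shift (suc v) (shift t (parts t (2 + i) unit)) n
    ∎
  where
  open ≡-Reasoning
  i = v ∸ t

sum-withSmallest : ∀ t .{{_ : NonZero t}} v n →
  sumFrom 1 v (λ x → shift x (λ m → ind ((x ≡ᵇ t) ∧ (0 ≡ᵇ m)) + withSmallest t (suc x ∸ t) m) n)
  ≡ withSmallest t (suc v ∸ t) n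
sum-withSmallest t zero    n rewrite m≤n⇒m∸n≡0 (>-nonZero⁻¹ t) = refl
sum-withSmallest t (suc v) n = trans (sumFrom-snoc 1 v _)
  (trans (cong₂ _+_ (sum-withSmallest t v n) refl) (sym (withSmallest-suc t v n)))

-- Induction on the length, classifying by the first entry. Entries are at least 1, so length n
-- suffices for sum n; they are capped by both b and u.
count-fits : ∀ t .{{_ : NonZero t}} b len u n → n ≤ len →
             countᵇ (fits t u n) (allLists b len) ≡ withSmallest t (suc (b ⊓ u) ∸ t) n
count-fits t b zero u zero n≤len = sym (at-zero t (suc (b ⊓ u) ∸ t))
  where
  at-zero : ∀ t .{{_ : NonZero t}} k → withSmallest t k 0 ≡ 0
  at-zero (suc t) zero    = refl
  at-zero (suc t) (suc k) = refl
count-fits t b (suc len) u n n≤len = begin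
  countᵇ (fits t u n) (concatMap (λ x → map (x ∷_) (allLists b len)) (map suc (upTo b)))
    ≡⟨ count-concatMap (fits t u n) (λ x → map (x ∷_) (allLists b len)) id 1 b (λ _ → refl) ⟩
  sumFrom 1 b φ
    -- Past `b ⊓ u` every remaining first entry x ≤ b exceeds u and contributes 0.
    ≡⟨ cong (λ k → sumFrom 1 k φ) (m+[n∸m]≡n (m⊓n≤m b u)) ⟨
  sumFrom 1 (b ⊓ u + (b ∸ b ⊓ u)) φ
    ≡⟨ sumFrom-++ 1 (b ⊓ u) (b ∸ b ⊓ u) φ ⟩
  sumFrom 1 (b ⊓ u) φ + sumFrom (suc (b ⊓ u)) (b ∸ b ⊓ u) φ
    ≡⟨ cong₂ _+_ (sumFrom-cong 1 (b ⊓ u) inside) (trans (sumFrom-cong (suc (b ⊓ u)) (b ∸ b ⊓ u) outside)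
         (trans (sumFrom-const (suc (b ⊓ u)) (b ∸ b ⊓ u) 0) (*-zeroʳ (b ∸ b ⊓ u)))) ⟩
  sumFrom 1 (b ⊓ u) (λ x → shift x (λ m → ind ((x ≡ᵇ t) ∧ (0 ≡ᵇ m)) + withSmallest t (suc x ∸ t) m) n) + 0
    ≡⟨ +-identityʳ _ ⟩
  sumFrom 1 (b ⊓ u) (λ x → shift x (λ m → ind ((x ≡ᵇ t) ∧ (0 ≡ᵇ m)) + withSmallest t (suc x ∸ t) m) n)
    ≡⟨ sum-withSmallest t (b ⊓ u) n ⟩
  withSmallest t (suc (b ⊓ u) ∸ t) n
    ∎
  where
  open ≡-Reasoning
  φ : ℕ → ℕ
  φ x = countᵇ (fits t u n) (map (x ∷_) (allLists b len))
  inside : ∀ x → 1 ≤ x → x < 1 + b ⊓ u →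
           φ x ≡ shift x (λ m → ind ((x ≡ᵇ t) ∧ (0 ≡ᵇ m)) + withSmallest t (suc x ∸ t) m) n
  inside (suc x) _ (s≤s x≤) = trans (count-∷ t u (suc x) n (allLists b len) (≤-trans x≤ (m⊓n≤n b u)))
    (shift-rel _≡_ refl (suc x) n (λ m e → cong₂ _+_ (count-empty b len ((suc x ≡ᵇ t) ∧ (0 ≡ᵇ m)))
      (trans (count-fits t b len (suc x) m (≤-pred (≤-trans (+-nonZero-< (suc x) e) n≤len)))
             (cong (λ k → withSmallest t (suc k ∸ t) m) (m≥n⇒m⊓n≡n (≤-trans x≤ (m⊓n≤m b u)))))))
  outside : ∀ x → b ⊓ u < x → x < suc (b ⊓ u) + (b ∸ b ⊓ u) → φ x ≡ 0
  outside x lo hi = count-∷-> t u x n (allLists b len) (≰⇒> λ x≤u →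
    <⇒≱ lo (⊓-glb (≤-pred (subst (λ k → x < suc k) (m+[n∸m]≡n (m⊓n≤m b u)) hi)) x≤u))

decreasing⇒smallest≤largest : ∀ π → T (decreasingᵇ π) → smallest π ≤ largest π
decreasing⇒smallest≤largest []          _ = z≤n
decreasing⇒smallest≤largest (x ∷ [])    _ = ≤-refl
decreasing⇒smallest≤largest (x ∷ y ∷ π) d =
  ≤-trans (decreasing⇒smallest≤largest (y ∷ π) (proj₂ y≤x,d)) (≤ᵇ⇒≤ y x (proj₁ y≤x,d))
  where y≤x,d = Equivalence.to (T-∧ {y ≤ᵇ x}) d

decreasing⇒positive : ∀ π → T (decreasingᵇ π) → 1 ≤ smallest π → T (positiveᵇ π)
decreasing⇒positive []          _ _ = _
decreasing⇒positive (x ∷ [])    _ p = Equivalence.from T-∧ (≤⇒≤ᵇ p , _)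
decreasing⇒positive (x ∷ y ∷ π) d p = Equivalence.from T-∧
  ( ≤⇒≤ᵇ (≤-trans p (decreasing⇒smallest≤largest (x ∷ y ∷ π) d))
  , decreasing⇒positive (y ∷ π) (proj₂ (Equivalence.to (T-∧ {y ≤ᵇ x}) d)) p)

smallest≤sum : ∀ π → smallest π ≤ sum π
smallest≤sum []          = z≤n
smallest≤sum (x ∷ [])    = m≤m+n x 0
smallest≤sum (x ∷ y ∷ π) = ≤-trans (smallest≤sum (y ∷ π)) (m≤n+m _ x)

count-partitionsOf : ∀ f n → countᵇ f (partitionsOf n)
  ≡ countᵇ (λ π → does (sum π ≟ n) ∧ (does (isPartitionᵇ π Bool.≟ true) ∧ f π)) (allLists n n)
count-partitionsOf f n = trans (count-filter f (λ π → isPartitionᵇ π Bool.≟ true) (filter (λ π → sum π ≟ n) (allLists n n)))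
                               (count-filter _ (λ π → sum π ≟ n) (allLists n n))

T-does : ∀ {A : Set} (a? : Dec A) → T (does a?) → A
T-does (yes a) _ = a

does-T : ∀ {A : Set} (a? : Dec A) → A → T (does a?)
does-T (yes _) _ = _
does-T (no ¬a) a = contradiction a ¬a

-- Bounds for the two counts in `Gcoeff`

module _ (L s : ℕ) .{{_ : NonZero s}} where

  minuend subtrahend : List ℕ → Bool
  minuend    π = nonemptyᵇ π ∧ (smallest π ≡ᵇ s) ∧ (largest π ∸ smallest π ≤ᵇ L)
  subtrahend π = nonemptyᵇ π ∧ (suc s ≤ᵇ smallest π) ∧ (largest π ∸ smallest π ≤ᵇ L)

  -- For n ≥ s + L the cap n on the entries does not restrict a largest part at most s + L, so all L
  -- + 1 sizes s, ..., s + L are available.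
  minuend-≥ : ∀ n → s + L ≤ n → shift s (parts s (suc L) unit) n ≤ countᵇ minuend (partitionsOf n)
  minuend-≥ n big = begin
    withSmallest s (suc L) n
      ≡⟨ cong (λ k → withSmallest s k n) (trans (cong (λ k → suc k ∸ s) (m≥n⇒m⊓n≡n big))
           (trans (cong (_∸ s) (sym (+-suc s L))) (m+n∸m≡n s (suc L)))) ⟨
    withSmallest s (suc (n ⊓ (s + L)) ∸ s) n
      ≡⟨ count-fits s n n (s + L) n ≤-refl ⟨
    countᵇ (fits s (s + L) n) (allLists n n)
      ≤⟨ count-mono sound (allLists n n) ⟩
    countᵇ _ (allLists n n)
      ≡⟨ count-partitionsOf minuend n ⟨
    countᵇ minuend (partitionsOf n)
      ∎
    where
    open ≤-Reasoning
    sound : ∀ π → T (fits s (s + L) n π) →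
            T (does (sum π ≟ n) ∧ (does (isPartitionᵇ π Bool.≟ true) ∧ minuend π))
    sound π t
      with t₁ , sum≡ ← Equivalence.to T-∧ t
      with t₂ , large ← Equivalence.to T-∧ t₁
      with t₃ , small ← Equivalence.to T-∧ t₂
      with ne , dec ← Equivalence.to T-∧ t₃ = Equivalence.from T-∧
        ( does-T (sum π ≟ n) (≡ᵇ⇒≡ _ n sum≡)
        , Equivalence.from T-∧
          ( does-T (isPartitionᵇ π Bool.≟ true) (Equivalence.to T-≡ (Equivalence.from T-∧
              (decreasing⇒positive π dec (subst (1 ≤_) (sym s≡) (>-nonZero⁻¹ s)) , dec)))
          , Equivalence.from T-∧ (ne , Equivalence.from T-∧ (small ,
              ≤⇒≤ᵇ (m≤n+o⇒m∸n≤o _ (smallest π) (subst (λ k → largest π ≤ k + L) (sym s≡) (≤ᵇ⇒≤ _ _ large)))))))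
      where
      s≡ : smallest π ≡ s
      s≡ = ≡ᵇ⇒≡ _ s small

  -- Classify by the smallest part t, which lies between s + 1 and n. The cap n on the entries can
  -- only lower each count.
  subtrahend-≤ : ∀ .{{_ : NonZero L}} n → countᵇ subtrahend (partitionsOf n) ≤ geom L (parts (suc s) L unit) n
  subtrahend-≤ n = begin
    countᵇ subtrahend (partitionsOf n)
      ≡⟨ count-partitionsOf subtrahend n ⟩
    countᵇ _ (allLists n n)
      ≤⟨ count-≤-sum (suc s) n complete (allLists n n) ⟩
    sumFrom (suc s) n (λ t → countᵇ (fits t (t + L) n) (allLists n n))
      ≤⟨ sumFrom-mono (suc s) n (λ t s<t _ → each t (>-nonZero (≤-<-trans z≤n s<t))) ⟩
    sumFrom (suc s) n (λ t → shift t (parts t (suc L) unit) n)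
      ≤⟨ sum-smallest-≤ L (suc s) n n ⟩
    geom L (parts (suc s) L unit) n
      ∎
    where
    open ≤-Reasoning
    complete : ∀ π → T (does (sum π ≟ n) ∧ (does (isPartitionᵇ π Bool.≟ true) ∧ subtrahend π)) →
               ∃[ t ] (suc s ≤ t × t < suc s + n × T (fits t (t + L) n π))
    complete π t
      with t₁ , t₂ ← Equivalence.to T-∧ t
      with t₃ , t₄ ← Equivalence.to T-∧ t₂
      with ne , t₅ ← Equivalence.to T-∧ t₄
      with low , diff ← Equivalence.to T-∧ t₅ =
        smallest π , ≤ᵇ⇒≤ _ _ low
        , s≤s (≤-trans (subst (smallest π ≤_) sum≡ (smallest≤sum π)) (m≤n+m n s))
        , Equivalence.from T-∧ (Equivalence.from T-∧ (Equivalence.from T-∧ (Equivalence.from T-∧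
            (ne , proj₂ (Equivalence.to (T-∧ {positiveᵇ π}) (Equivalence.from T-≡ (T-does (isPartitionᵇ π Bool.≟ true) t₃))))
            , ≡⇒≡ᵇ (smallest π) _ refl)
            , ≤⇒≤ᵇ (≤-trans (m≤n+m∸n (largest π) (smallest π)) (+-monoʳ-≤ (smallest π) (≤ᵇ⇒≤ _ L diff))))
            , ≡⇒≡ᵇ _ n sum≡)
      where
      sum≡ : sum π ≡ n
      sum≡ = T-does (sum π ≟ n) t₁
    each : ∀ t → NonZero t → countᵇ (fits t (t + L) n) (allLists n n) ≤ shift t (parts t (suc L) unit) n
    each t t≢0 = ≤-trans (≤-reflexive (count-fits t n n (t + L) n ≤-refl))
      (mono-k (suc (n ⊓ (t + L)) ∸ t) (≤-trans (∸-monoˡ-≤ t (s≤s (m⊓n≤n n (t + L))))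
        (≤-reflexive (trans (cong (_∸ t) (sym (+-suc t L))) (m+n∸m≡n t (suc L))))))
      where
      instance _ = t≢0
      mono-k : ∀ k → k ≤ suc L → withSmallest t k n ≤ shift t (parts t (suc L) unit) n
      mono-k zero    _    = z≤n
      mono-k (suc k) k≤L = shift-mono t (parts-≤ t unit k≤L) n

-- Size of Γ(s) against the threshold

pow-+ : ∀ {x a b} k → 2 ≤ x → a ≤ x ^ k → b ≤ x ^ k → a + b ≤ x ^ suc k
pow-+ {x} k 2≤x a≤ b≤ = ≤-trans (+-mono-≤ a≤ b≤)
  (≤-trans (≤-reflexive (cong (x ^ k +_) (sym (+-identityʳ (x ^ k))))) (*-monoˡ-≤ (x ^ k) 2≤x))

-- As σ ≥ 2, an addition costs at most one power of σ. This gives Y ≤ σ^6, V ≤ σ^10 and s + Y ≤ σ^7,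
-- hence a product of at most σ^23.
threshold<σ^24 : ∀ s .{{_ : NonZero s}} → let open Thresholds s in Y * (V * (s + Y)) < σ ^ 24
threshold<σ^24 s = ≤-<-trans
  (≤-trans (*-mono-≤ Y≤ (*-mono-≤ V≤ (pow-+ 6 2≤σ (up 1 6 (s≤s z≤n) s≤σ¹) Y≤)))
           (≤-reflexive (trans (cong (σ ^ 6 *_) (sym (^-distribˡ-+-* σ 10 7))) (sym (^-distribˡ-+-* σ 6 17)))))
  (^-monoʳ-< σ 2≤σ (≤-refl {24}))
  where
  open Thresholds s
  1≤s : 1 ≤ s
  1≤s = >-nonZero⁻¹ s
  2≤σ : 2 ≤ σ
  2≤σ = *-mono-≤ (s≤s 1≤s) 1≤s
  up : ∀ {a} j k → j ≤ k → a ≤ σ ^ j → a ≤ σ ^ k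
  up j k j≤k a≤ = ≤-trans a≤ (^-monoʳ-≤ σ {{>-nonZero (<⇒≤ 2≤σ)}} j≤k)
  times : ∀ {a} k → a ≤ σ ^ k → a * σ ≤ σ ^ suc k
  times {a} k a≤ = ≤-trans (≤-reflexive (*-comm a σ)) (*-monoʳ-≤ σ a≤)
  σ¹ : ∀ {a} → a ≤ σ → a ≤ σ ^ 1
  σ¹ a≤ = ≤-trans a≤ (≤-reflexive (sym (^-identityʳ σ)))
  s≤σ¹ : s ≤ σ ^ 1
  s≤σ¹ = σ¹ (m≤m+n s (s * s))
  ss≤σ : s * s ≤ σ
  ss≤σ = m≤n+m (s * s) s
  2+M₁≤ : 2 + M₁ ≤ σ ^ 4
  2+M₁≤ = pow-+ 3 2≤σ (up 1 3 (s≤s z≤n) (σ¹ 2≤σ))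
    (pow-+ 2 2≤σ (up 1 2 (s≤s z≤n) (σ¹ ss≤σ)) (pow-+ 1 2≤σ (σ¹ ss≤σ) (σ¹ ≤-refl)))
  Y≤ : Y ≤ σ ^ 6
  Y≤ = pow-+ 5 2≤σ (times 4 2+M₁≤) (up 0 5 z≤n ≤-refl)
  V≤ : V ≤ σ ^ 10
  V≤ = pow-+ 9 2≤σ (times 8 (pow-+ 7 2≤σ (up 4 7 (m≤m+n 4 3) 2+M₁≤) (pow-+ 6 2≤σ Y≤ Y≤))) (up 0 9 z≤n ≤-refl)

-- The product P contains the factors (s + 1)(s + 2) ≥ σ, and its exponent in Γ(s) is at least 24.
σ^24≤Γ : ∀ s .{{_ : NonZero s}} → Thresholds.σ s ^ 24 ≤ Γ s
σ^24≤Γ s = begin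
  σ ^ 24                         ≤⟨ ^-monoˡ-≤ 24 (≤-trans σ≤ Q≤P) ⟩
  Q ^ 24                         ≤⟨ ^-monoʳ-≤ Q 24≤e ⟩
  Q ^ e                          ≤⟨ m≤m+n _ _ ⟩
  Q ^ e + R                      ≡⟨ *-identityˡ _ ⟨
  1 * (Q ^ e + R)                ≤⟨ *-monoˡ-≤ (Q ^ e + R) 1≤Σ ⟩
  Γ s                            ∎
  where
  open ≤-Reasoning
  open Thresholds s using (σ)
  l Q e R : ℕ
  l = 3 * s + 2
  Q = P l s
  e = (Q ^ 2 ∸ 1) * l + 2
  R = ((Q ^ 2 ∸ 1) * l ∸ 2) * Q
  1≤s : 1 ≤ s
  1≤s = >-nonZero⁻¹ s
  Π≥ : ∀ k → (s + 1) * (s + 2) ≤ Πℕ< (2 + k) (λ i → s + suc i)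
  Π≥ zero    = ≤-reflexive (cong (_* (s + 2)) (sym (*-identityˡ (s + 1))))
  Π≥ (suc k) = ≤-trans (Π≥ k) (≤-trans (≤-reflexive (sym (*-identityʳ _)))
    (*-monoʳ-≤ (Πℕ< (2 + k) (λ i → s + suc i)) (≤-trans 1≤s (m≤m+n s _))))
  Q≤P : (s + 1) * (s + 2) ≤ Q
  Q≤P = subst (λ k → (s + 1) * (s + 2) ≤ Πℕ< k (λ i → s + suc i)) (+-comm 2 (3 * s)) (Π≥ (3 * s))
  σ≤ : σ ≤ (s + 1) * (s + 2)
  σ≤ = *-mono-≤ (≤-reflexive (+-comm 1 s)) (m≤m+n s 2)
  6≤Q : 6 ≤ Q
  6≤Q = ≤-trans (*-mono-≤ (+-monoˡ-≤ 1 1≤s) (+-monoˡ-≤ 2 1≤s)) Q≤P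
  instance
    Q-nonZero : NonZero Q
    Q-nonZero = >-nonZero (≤-trans (s≤s z≤n) 6≤Q)
  24≤e : 24 ≤ e
  -- From P ≥ 6 and s ≥ 1 one has P² - 1 ≥ 35 and 3s + 2 ≥ 5, so the exponent is at least 35·5 + 2.
  24≤e = ≤-trans (m≤m+n 24 (35 * 5 ∸ 22)) (+-monoˡ-≤ 2 (*-mono-≤ {35} {Q ^ 2 ∸ 1} (∸-monoˡ-≤ 1 (^-monoˡ-≤ 2 6≤Q))
    (+-monoˡ-≤ 2 (*-monoʳ-≤ 3 1≤s))))
  1≤Σ : 1 ≤ Σℕ< l (λ i → s + suc i)
  1≤Σ = subst (λ k → 1 ≤ Σℕ< k (λ i → s + suc i)) (+-comm 1 (3 * s + 1) ⟨ trans ⟩ +-assoc (3 * s) 1 1)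
    (≤-trans 1≤s (≤-trans (m≤m+n s _) (m≤n+m (s + suc (3 * s + 1)) (Σℕ< (3 * s + 1) (λ i → s + suc i)))))

-- Nonnegativity of the coefficients

open import Data.Integer using (+_)
import Data.Integer

theorem6 : (L s : ℕ) → 1 ≤ s → s + 1 ≤ L →
    (n : ℕ) → η₃ L s ≤ n → + 0 Data.Integer.≤ Gcoeff L s n
theorem6 L s 1≤s s+1≤L n η₃≤n = ℤ.i≤j⇒0≤j-i (Data.Integer.+≤+ (begin
  countᵇ (subtrahend L s) (partitionsOf n)      ≤⟨ subtrahend-≤ L s n ⟩
  geom L (parts (suc s) L unit) n               ≤⟨ geom-L≤geom-s s L s<L n (<-≤-trans large Γ≤n) ⟩
  -- By definition `parts s (suc L) unit` is `geom s (parts (suc s) L unit)`.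
  shift s (parts s (suc L) unit) n              ≤⟨ minuend-≥ L s n s+L≤n ⟩
  countᵇ (minuend L s) (partitionsOf n)         ∎))
  where
  open ≤-Reasoning
  open Thresholds s
  s<L : s < L
  s<L = subst (_≤ L) (+-comm s 1) s+1≤L
  instance
    s-nonZero : NonZero s
    s-nonZero = >-nonZero 1≤s
    L-nonZero : NonZero L
    L-nonZero = >-nonZero (≤-<-trans z≤n s<L)
  large : Y * (V * (s + Y)) < Γ s
  large = <-≤-trans (threshold<σ^24 s) (σ^24≤Γ s)
  -- The factor L + 1 leaves room for both Γ(s) ≤ n and s + L ≤ n.
  LΓ≤n : Γ s + L * Γ s ≤ n
  LΓ≤n = ≤-trans (*-monoʳ-≤ (suc L) (m≤n⊔m (η₁ L s) (Γ s))) η₃≤n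
  Γ≤n : Γ s ≤ n
  Γ≤n = ≤-trans (m≤m+n (Γ s) _) LΓ≤n
  s≤Γ : s ≤ Γ s
  s≤Γ = ≤-trans (≤-trans (≤-trans (m≤m+n s (s * s)) (≤-reflexive (sym (^-identityʳ σ))))
    (^-monoʳ-≤ σ {{m*n≢0 (suc s) s}} (s≤s (z≤n {23})))) (σ^24≤Γ s)
  s+L≤n : s + L ≤ n
  s+L≤n = ≤-trans (+-mono-≤ s≤Γ (≤-trans (≤-reflexive (sym (*-identityʳ L)))
    (*-monoʳ-≤ L (≤-trans 1≤s s≤Γ)))) LΓ≤n
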